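{- There is an absolute constant $c>0$ such that the following holds for all sufficiently large $n$. Let $L_1,\dots,L_n\colon\mathbb{F}_2^m\to\mathbb{F}_2$ be polynomials of degree at most $1$ and let $\mathcal{L}=(L_1,\dots,L_n)$ be the distribution on $\{0,1\}^n$ of $(L_1(X),\dots,L_n(X))$ for $X$ uniform on $\mathbb{F}_2^m$. Then \[ \|\mathcal{L}-\mathrm{Ber}(1/3)^{\otimes n}\|_{\mathtt{TV}}\ \ge\ 1-2^{ -cn}. \]
   Context: $\mathrm{Ber}(1/3)^{\otimes n}$ is the product of $n$ independent Bernoulli$(1/3)$ bits. The total variation distance is $\|\mathcal{D}_1-\mathcal{D}_2\|_{\mathtt{TV}}=\frac12\sum_x|\mathcal{D}_1(x)-\mathcal{D}_2(x)|$. -}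

module Defs where

open import Data.Bool.Base using (Bool; true; false; _∧_; _xor_; if_then_else_)
open import Data.Bool.Properties using (_≟_)
open import Data.Fin.Base using (Fin)
open import Data.Fin.Subset using (Subset) renaming (∣_∣ to card)
open import Data.Integer.Base using (ℤ; +_; -[1+_])
open import Data.List.Base using (List; []; _∷_; _++_; map; foldr; filter; length)
open import Data.List.Relation.Unary.All using (All)
open import Data.Nat.Base as ℕ using (ℕ; zero; suc)
open import Data.Nat.Properties using (m^n≢0)
open import Data.Product.Base using (∃; _×_)
open import Data.Rational.Base as ℚ using (ℚ; 0ℚ; 1ℚ; ½; _/_; _+_; _*_; _-_; ∣_∣; _≤_; *-1-rawMonoid)
open import Data.Rational.Unnormalised.Base as ℚᵘ using (ℚᵘ)
open import Data.Sum.Base using (_⊎_)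
open import Data.Vec.Base as Vec using (Vec)
open import Data.Vec.Properties using (≡-dec)
open import Algebra.Definitions.RawMonoid *-1-rawMonoid using () renaming (_×_ to power)
open import Relation.Binary.PropositionalEquality.Core using (_≡_)

-- Addition is _xor_ and multiplication is _∧_.
F₂ : Set
F₂ = Bool

private
  variable
    m n : ℕ

-- The product of the variables x_i with i ∈ S.
monomial : Subset m → Vec F₂ m → F₂
monomial S x = Vec.foldr′ _∧_ true (Vec.zipWith (λ s b → if s then b else true) S x)

-- A polynomial is the sum of the listed monomials. Since b * b = b in F₂,
-- square-free monomials give all polynomial functions.
Polynomial : ℕ → Set
Polynomial m = List (Subset m)

eval : Polynomial m → Vec F₂ m → F₂
eval p x = foldr _xor_ false (map (λ S → monomial S x) p)

HasDegreeAtMost : ℕ → (Vec F₂ m → F₂) → Set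
HasDegreeAtMost {m} d f =
  ∃ λ (p : Polynomial m) → All (λ S → card S ℕ.≤ d) p × (∀ x → f x ≡ eval p x)

-- Every element of {0,1}ⁿ occurs exactly once.
cube : ∀ n → List (Vec Bool n)
cube zero    = Vec.[] ∷ []
cube (suc n) = map (false Vec.∷_) (cube n) ++ map (true Vec.∷_) (cube n)

-- Probability mass functions.
PMF : ℕ → Set
PMF n = Vec Bool n → ℚ

-- The distribution of (L₁(X), …, Lₙ(X)) for X uniform on F₂ᵐ.
outputDistribution : (Fin n → Vec F₂ m → F₂) → PMF n
outputDistribution {m = m} L y =
  _/_ (+ length (filter (λ x → ≡-dec _≟_ (Vec.tabulate (λ i → L i x)) y) (cube m)))
      (2 ℕ.^ m) {{m^n≢0 2 m}}

bernoulli : ℚ → Bool → ℚ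
bernoulli p b = if b then p else 1ℚ - p

bernoulliProduct : ℚ → ∀ n → PMF n
bernoulliProduct p n y = Vec.foldr′ _*_ 1ℚ (Vec.map (bernoulli p) y)

TV : PMF n → PMF n → ℚ
TV {n} D₁ D₂ = ½ * foldr _+_ 0ℚ (map (λ x → ∣ D₁ x - D₂ x ∣) (cube n))

infixr 8 _^_
_^_ : ℚ → ℕ → ℚ
x ^ k = power k x

2^ℤ_ : ℤ → ℚ
2^ℤ (+ k)    = (+ 2 / 1) ^ k
2^ℤ -[1+ k ] = ½ ^ suc k

-- x ≤2^ r says x ≤ 2ʳ as real numbers: for r = p / q with q > 0 and x > 0 this is
-- x^q ≤ 2^p. The condition does not depend on the fraction representing r, so r is
-- left unnormalised.
infix 4 _≤2^_
_≤2^_ : ℚ → ℚᵘ → Set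
x ≤2^ r = x ≤ 0ℚ ⊎ x ^ ℚᵘ.↧ₙ r ≤ 2^ℤ (ℚᵘ.↥ r)

{-# OPTIONS --safe #-}
-- The overlap 1 - TV is at most any ∑ w with w ≥ 0 and w² ≥ D·B pointwise, where D is the output
-- distribution and B the Bernoulli product. For a uniform distribution on an affine subspace, each
-- bit given the previous ones is either constant or uniform, so √(D·B) is a product over the bits,
-- and revealing one bit contributes a factor at most √(2/3) or √(1/6) + √(1/3) < 70/71.
-- Affinity enters only through invariance of D under c ↦ c ⊕ a ⊕ b for a, b in its support.
module Submission where

open import Defs
open import Algebra.Bundles using (CommutativeRing)
open import Algebra.Properties.CommutativeSemigroup using (interchange)
open import Data.Bool.Base using (Bool; true; false; _∧_; _xor_; if_then_else_)
open import Data.Bool.Properties as Bool using (xor-assoc; xor-same; xor-identityʳ; xor-∧-commutativeRing)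
open import Data.Fin.Base as Fin using (Fin)
open import Data.Fin.Subset using (Subset) renaming (∣_∣ to card)
open import Data.Integer.Base as ℤ using (+_)
open import Data.Integer.Properties as ℤ using ()
open import Data.List.Base using (List; []; _∷_; _++_; map; foldr; filter; length)
open import Data.List.Properties using (map-∘)
open import Data.List.Relation.Unary.All using (All; []; _∷_)
open import Data.Nat.Base as ℕ using (ℕ; zero; suc; _≤_)
open import Data.Nat.Properties as ℕ using (m^n≢0)
open import Data.Product.Base using (∃; _×_; _,_)
open import Data.Rational.Base as ℚ using (ℚ; 0ℚ; 1ℚ; ½; _<_; _+_; _*_; -_; _-_; _/_; ∣_∣; toℚᵘ)
open import Data.Rational.Properties as ℚ using ()
open import Data.Rational.Solver using (module +-*-Solver)
open import Data.Rational.Unnormalised.Base as ℚᵘ using ()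
open import Data.Rational.Unnormalised.Properties as ℚᵘ using ()
open import Data.Sum.Base using (_⊎_; inj₁; inj₂)
open import Data.Vec.Base as Vec using (Vec; tabulate; zipWith)
open import Data.Vec.Properties as Vec using (≡-dec)
open import Function.Base using (_∘_; case_of_)
open import Function.Bundles using (_⇔_; mk⇔)
open import Algebra.Properties.CommutativeMonoid.Mult ℚ.*-1-commutativeMonoid using (×-assocˡ)
open import Relation.Binary.PropositionalEquality
open import Relation.Nullary.Decidable using (Dec; yes; no; does; from-yes; does-⇔)
open import Relation.Nullary.Negation using (contradiction)

private
  variable
    A B : Set
    m n : ℕ

-- Finite sums of rationals over lists.

sumOver : List A → (A → ℚ) → ℚ
sumOver xs f = foldr _+_ 0ℚ (map f xs)

sumOver-cong : (xs : List A) {f g : A → ℚ} → (∀ x → f x ≡ g x) → sumOver xs f ≡ sumOver xs g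
sumOver-cong []       f≗g = refl
sumOver-cong (x ∷ xs) f≗g = cong₂ _+_ (f≗g x) (sumOver-cong xs f≗g)

sumOver-0 : (xs : List A) → sumOver xs (λ _ → 0ℚ) ≡ 0ℚ
sumOver-0 []       = refl
sumOver-0 (x ∷ xs) = trans (ℚ.+-identityˡ _) (sumOver-0 xs)

sumOver-+ : (xs : List A) (f g : A → ℚ) → sumOver xs (λ x → f x + g x) ≡ sumOver xs f + sumOver xs g
sumOver-+ []       f g = refl
sumOver-+ (x ∷ xs) f g = trans (cong (_+_ (f x + g x)) (sumOver-+ xs f g))
  (interchange (CommutativeRing.+-commutativeSemigroup ℚ.+-*-commutativeRing) (f x) (g x) _ _)

sumOver-*ˡ : (c : ℚ) (xs : List A) (f : A → ℚ) → sumOver xs (λ x → c * f x) ≡ c * sumOver xs f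
sumOver-*ˡ c []       f = sym (ℚ.*-zeroʳ c)
sumOver-*ˡ c (x ∷ xs) f = trans (cong (_+_ (c * f x)) (sumOver-*ˡ c xs f)) (sym (ℚ.*-distribˡ-+ c (f x) _))

sumOver-mono : (xs : List A) {f g : A → ℚ} → (∀ x → f x ℚ.≤ g x) → sumOver xs f ℚ.≤ sumOver xs g
sumOver-mono []       f≤g = ℚ.≤-refl
sumOver-mono (x ∷ xs) f≤g = ℚ.+-mono-≤ (f≤g x) (sumOver-mono xs f≤g)

sumOver-nonNeg : (xs : List A) {f : A → ℚ} → (∀ x → 0ℚ ℚ.≤ f x) → 0ℚ ℚ.≤ sumOver xs f
sumOver-nonNeg xs {f} 0≤f = subst (ℚ._≤ sumOver xs f) (sumOver-0 xs) (sumOver-mono xs 0≤f)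

sumOver-++ : (xs ys : List A) (f : A → ℚ) → sumOver (xs ++ ys) f ≡ sumOver xs f + sumOver ys f
sumOver-++ []       ys f = sym (ℚ.+-identityˡ _)
sumOver-++ (x ∷ xs) ys f = trans (cong (_+_ (f x)) (sumOver-++ xs ys f)) (sym (ℚ.+-assoc (f x) _ _))

sumOver-map : (g : A → B) (xs : List A) (f : B → ℚ) → sumOver (map g xs) f ≡ sumOver xs (f ∘ g)
sumOver-map g xs f = cong (foldr _+_ 0ℚ) (sym (map-∘ xs))

sumOver-swap : (xs : List A) (ys : List B) (f : A → B → ℚ) →
  sumOver xs (λ x → sumOver ys (f x)) ≡ sumOver ys (λ y → sumOver xs (λ x → f x y))
sumOver-swap []       ys f = sym (sumOver-0 ys)
sumOver-swap (x ∷ xs) ys f =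
  trans (cong (_+_ (sumOver ys (f x))) (sumOver-swap xs ys f)) (sym (sumOver-+ ys (f x) _))

-- On `ℚ`, `_/_` reduces to lowest terms and does not compute for a variable `d`. The identity is
-- checked by cross-multiplying unnormalised fractions and carried back by injectivity of `toℚᵘ`.
/-+ : ∀ a b d .{{_ : ℕ.NonZero d}} → (+ a) / d + (+ b) / d ≡ (+ (a ℕ.+ b)) / d
/-+ a b d@(suc _) = ℚ.toℚᵘ-injective (begin
  toℚᵘ ((+ a) / d + (+ b) / d)                ≈⟨ ℚ.toℚᵘ-homo-+ ((+ a) / d) ((+ b) / d) ⟩
  toℚᵘ ((+ a) / d) ℚᵘ.+ toℚᵘ ((+ b) / d)     ≈⟨ ℚᵘ.+-cong (ℚ.toℚᵘ-fromℚᵘ ((+ a) ℚᵘ./ d)) (ℚ.toℚᵘ-fromℚᵘ ((+ b) ℚᵘ./ d)) ⟩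
  (+ a) ℚᵘ./ d ℚᵘ.+ (+ b) ℚᵘ./ d             ≈⟨ ℚᵘ.*≡* cross ⟩
  (+ (a ℕ.+ b)) ℚᵘ./ d                        ≈⟨ ℚ.toℚᵘ-fromℚᵘ ((+ (a ℕ.+ b)) ℚᵘ./ d) ⟨
  toℚᵘ ((+ (a ℕ.+ b)) / d)                    ∎)
  where
  open ℚᵘ.≃-Reasoning
  cross : (+ a ℤ.* + d ℤ.+ + b ℤ.* + d) ℤ.* + d ≡ + (a ℕ.+ b) ℤ.* (+ d ℤ.* + d)
  cross = trans (cong (ℤ._* + d) (sym (ℤ.*-distribʳ-+ (+ d) (+ a) (+ b)))) (ℤ.*-assoc (+ a ℤ.+ + b) (+ d) (+ d))

-- Sums over the cube and their translations.

∑ : ∀ n → (Vec Bool n → ℚ) → ℚ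
∑ n = sumOver (cube n)

∑-suc : ∀ n (f : Vec Bool (suc n) → ℚ) → ∑ (suc n) f ≡ ∑ n (f ∘ (false Vec.∷_)) + ∑ n (f ∘ (true Vec.∷_))
∑-suc n f = trans (sumOver-++ (map (false Vec.∷_) (cube n)) _ f)
  (cong₂ _+_ (sumOver-map (false Vec.∷_) (cube n) f) (sumOver-map (true Vec.∷_) (cube n) f))

∑-const : ∀ n k d .{{_ : ℕ.NonZero d}} → ∑ n (λ _ → (+ k) / d) ≡ (+ (2 ℕ.^ n ℕ.* k)) / d
∑-const zero    k d = trans (ℚ.+-identityʳ _) (cong (λ j → (+ j) / d) (sym (ℕ.*-identityˡ k)))
∑-const (suc n) k d = begin
  ∑ (suc n) (λ _ → (+ k) / d)                             ≡⟨ ∑-suc n _ ⟩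
  ∑ n (λ _ → (+ k) / d) + ∑ n (λ _ → (+ k) / d)           ≡⟨ cong₂ _+_ (∑-const n k d) (∑-const n k d) ⟩
  (+ (2 ℕ.^ n ℕ.* k)) / d + (+ (2 ℕ.^ n ℕ.* k)) / d       ≡⟨ /-+ (2 ℕ.^ n ℕ.* k) (2 ℕ.^ n ℕ.* k) d ⟩
  (+ (2 ℕ.^ n ℕ.* k ℕ.+ 2 ℕ.^ n ℕ.* k)) / d               ≡⟨ cong (λ j → (+ j) / d) double ⟩
  (+ (2 ℕ.^ suc n ℕ.* k)) / d                             ∎
  where
  open ≡-Reasoning
  double : 2 ℕ.^ n ℕ.* k ℕ.+ 2 ℕ.^ n ℕ.* k ≡ 2 ℕ.^ suc n ℕ.* k
  double = trans (sym (ℕ.*-distribʳ-+ k (2 ℕ.^ n) (2 ℕ.^ n)))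
    (cong (λ j → (2 ℕ.^ n ℕ.+ j) ℕ.* k) (sym (ℕ.+-identityʳ (2 ℕ.^ n))))

infixl 6 _⊕_
_⊕_ : Vec Bool n → Vec Bool n → Vec Bool n
_⊕_ = zipWith _xor_

⊕-cancelʳ : (x t : Vec Bool n) → (x ⊕ t) ⊕ t ≡ x
⊕-cancelʳ Vec.[]      Vec.[]      = refl
⊕-cancelʳ (b Vec.∷ x) (s Vec.∷ t) = cong₂ Vec._∷_
  (trans (xor-assoc b s s) (trans (cong (b xor_) (xor-same s)) (xor-identityʳ b))) (⊕-cancelʳ x t)

-- A head `false` in `t` keeps each half of the cube and a head `true` swaps the halves, so
-- induction applies within each half. Used on outputs to compare two slices, and on inputs to
-- compare two fibres.
∑-translate : ∀ n (t : Vec Bool n) (f : Vec Bool n → ℚ) → ∑ n (λ x → f (x ⊕ t)) ≡ ∑ n f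
∑-translate zero    Vec.[]          f = refl
∑-translate (suc n) (false Vec.∷ t) f = begin
  ∑ (suc n) (λ x → f (x ⊕ (false Vec.∷ t)))                          ≡⟨ ∑-suc n _ ⟩
  ∑ n (λ x → f (false Vec.∷ x ⊕ t)) + ∑ n (λ x → f (true Vec.∷ x ⊕ t)) ≡⟨ cong₂ _+_ (∑-translate n t _) (∑-translate n t _) ⟩
  ∑ n (f ∘ (false Vec.∷_)) + ∑ n (f ∘ (true Vec.∷_))                 ≡⟨ ∑-suc n f ⟨
  ∑ (suc n) f                                                        ∎
  where open ≡-Reasoning
∑-translate (suc n) (true Vec.∷ t) f = begin
  ∑ (suc n) (λ x → f (x ⊕ (true Vec.∷ t)))                           ≡⟨ ∑-suc n _ ⟩
  ∑ n (λ x → f (true Vec.∷ x ⊕ t)) + ∑ n (λ x → f (false Vec.∷ x ⊕ t)) ≡⟨ cong₂ _+_ (∑-translate n t _) (∑-translate n t _) ⟩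
  ∑ n (f ∘ (true Vec.∷_)) + ∑ n (f ∘ (false Vec.∷_))                 ≡⟨ ℚ.+-comm (∑ n (f ∘ (true Vec.∷_))) _ ⟩
  ∑ n (f ∘ (false Vec.∷_)) + ∑ n (f ∘ (true Vec.∷_))                 ≡⟨ ∑-suc n f ⟨
  ∑ (suc n) f                                                        ∎
  where open ≡-Reasoning

-- Functions uniform on an affine subspace and their weights.

zero-or-support : ∀ n (f : Vec Bool n → ℚ) → (∀ y → f y ≡ 0ℚ) ⊎ ∃ λ y → f y ≢ 0ℚ
zero-or-support zero f = case f Vec.[] ℚ.≟ 0ℚ of λ where
  (yes f≡0) → inj₁ λ where Vec.[] → f≡0
  (no  f≢0) → inj₂ (Vec.[] , f≢0)
zero-or-support (suc n) f = case zero-or-support n (f ∘ (false Vec.∷_)) of λ where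
  (inj₂ (y , f≢0)) → inj₂ (_ , f≢0)
  (inj₁ f₀≡0) → case zero-or-support n (f ∘ (true Vec.∷_)) of λ where
    (inj₂ (y , f≢0)) → inj₂ (_ , f≢0)
    (inj₁ f₁≡0) → inj₁ λ where
      (false Vec.∷ y) → f₀≡0 y
      (true  Vec.∷ y) → f₁≡0 y

-- f is a multiple of the indicator function of an affine subspace.
CosetUniform : (Vec Bool n → ℚ) → Set
CosetUniform f = ∀ a b c → f a ≢ 0ℚ → f b ≢ 0ℚ → f (c ⊕ (a ⊕ b)) ≡ f c

-- Points with equal first bit differ by a shift that fixes the first bit. Splitting on `s` makes
-- `s xor (s xor s)` compute to `s`.
slice-cosetUniform : (f : Vec Bool (suc n) → ℚ) → CosetUniform f → ∀ s → CosetUniform (f ∘ (s Vec.∷_))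
slice-cosetUniform f cu false a b c = cu (false Vec.∷ a) (false Vec.∷ b) (false Vec.∷ c)
slice-cosetUniform f cu true  a b c = cu (true Vec.∷ a) (true Vec.∷ b) (true Vec.∷ c)

Ber⅓ : ∀ n → PMF n
Ber⅓ = bernoulliProduct (+ 1 / 3)

ρ : ℚ
ρ = + 70 / 71

-- The bound on the squares says that s ↦ κ s dominates the Bhattacharyya terms of the first bit,
-- whose distribution under f is constant or uniform. In the uniform case κ is a rational
-- upper approximation of (√(1/3), √(1/6)) with sum ρ < 1.
first-bit : ∀ n (f : Vec Bool (suc n) → ℚ) → (∀ y → 0ℚ ℚ.≤ f y) → CosetUniform f →
  ∃ λ (κ : Bool → ℚ) → (∀ s → 0ℚ ℚ.≤ κ s) × κ false + κ true ≡ ρ ×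
    (∀ s → bernoulli (+ 1 / 3) s * ∑ n (f ∘ (s Vec.∷_)) ℚ.≤ ∑ (suc n) f * (κ s * κ s))
first-bit n f 0≤f cu =
  case zero-or-support n (f ∘ (false Vec.∷_)) of λ where
    (inj₁ f₀≡0) →
      let S₀≡0 = trans (sumOver-cong (cube n) f₀≡0) (sumOver-0 (cube n)) in
      -- At `true` any square of at least 1/3 would do; `ρ` is taken so that the two values have the
      -- same sum in every case. An identically zero `f` also lands here, and then both sides of
      -- each bound vanish.
      (λ where false → 0ℚ ; true → ρ) ,
      (λ where false → ℚ.≤-refl ; true → from-yes (0ℚ ℚ.≤? ρ)) ,
      refl ,
      (λ where false → impossible (bernoulli (+ 1 / 3) false) T S₀≡0
               true  → certain ρ true (from-yes (bernoulli (+ 1 / 3) true ℚ.≤? ρ * ρ))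
                         (trans T≡ (trans (cong (_+ S true) S₀≡0) (ℚ.+-identityˡ (S true)))))
    (inj₂ (a , fa≢0)) → case zero-or-support n (f ∘ (true Vec.∷_)) of λ where
      (inj₁ f₁≡0) →
        let S₁≡0 = trans (sumOver-cong (cube n) f₁≡0) (sumOver-0 (cube n)) in
        (λ where false → ρ ; true → 0ℚ) ,
        (λ where false → from-yes (0ℚ ℚ.≤? ρ) ; true → ℚ.≤-refl) ,
        refl ,
        (λ where false → certain ρ false (from-yes (bernoulli (+ 1 / 3) false ℚ.≤? ρ * ρ))
                           (trans T≡ (trans (cong (_+_ (S false)) S₁≡0) (ℚ.+-identityʳ (S false))))
                 true  → impossible (bernoulli (+ 1 / 3) true) T S₁≡0)
      (inj₂ (b , fb≢0)) →
        -- The support points have first bits `false` and `true`, so the shift by their sum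
        -- exchanges the two slices and preserves `f`. Hence both slices carry the same mass.
        let S₁≡S₀ = trans (sym (∑-translate n (a ⊕ b) (f ∘ (true Vec.∷_))))
              (sumOver-cong (cube n) λ c → cu (false Vec.∷ a) (true Vec.∷ b) (false Vec.∷ c) fa≢0 fb≢0) in
        (λ where false → + 41 / 71 ; true → + 29 / 71) ,
        (λ where false → from-yes (0ℚ ℚ.≤? + 41 / 71) ; true → from-yes (0ℚ ℚ.≤? + 29 / 71)) ,
        refl ,
        (λ where false → uniform (+ 41 / 71) false
                           (from-yes (bernoulli (+ 1 / 3) false ℚ.≤? + 41 / 71 * (+ 41 / 71) + + 41 / 71 * (+ 41 / 71)))
                           (trans T≡ (cong (_+_ (S false)) S₁≡S₀))
                 true  → uniform (+ 29 / 71) true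
                           (from-yes (bernoulli (+ 1 / 3) true ℚ.≤? + 29 / 71 * (+ 29 / 71) + + 29 / 71 * (+ 29 / 71)))
                           (trans T≡ (cong (_+ S true) (sym S₁≡S₀))))
  where
  S : Bool → ℚ
  S s = ∑ n (f ∘ (s Vec.∷_))

  T : ℚ
  T = ∑ (suc n) f

  T≡ : T ≡ S false + S true
  T≡ = ∑-suc n f

  S-nonNeg : ∀ s → ℚ.NonNegative (S s)
  S-nonNeg s = ℚ.nonNegative (sumOver-nonNeg (cube n) λ y → 0≤f (s Vec.∷ y))

  impossible : ∀ p u {v} → v ≡ 0ℚ → p * v ℚ.≤ u * (0ℚ * 0ℚ)
  impossible p u v≡0 = ℚ.≤-reflexive (trans (trans (cong (p *_) v≡0) (ℚ.*-zeroʳ p)) (sym (ℚ.*-zeroʳ u)))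

  certain : ∀ {p} k s → p ℚ.≤ k * k → T ≡ S s → p * S s ℚ.≤ T * (k * k)
  certain {p} k s le T≡S = subst (p * S s ℚ.≤_)
    (trans (ℚ.*-comm (k * k) (S s)) (cong (_* (k * k)) (sym T≡S)))
    (ℚ.*-monoʳ-≤-nonNeg (S s) {{S-nonNeg s}} le)

  open +-*-Solver

  uniform : ∀ {p} k s → p ℚ.≤ k * k + k * k → T ≡ S s + S s → p * S s ℚ.≤ T * (k * k)
  uniform {p} k s le T≡2S = subst (p * S s ℚ.≤_)
    (trans (solve 2 (λ k v → (k :* k :+ k :* k) :* v := (v :+ v) :* (k :* k)) refl k (S s))
      (cong (_* (k * k)) (sym T≡2S)))
    (ℚ.*-monoʳ-≤-nonNeg (S s) {{S-nonNeg s}} le)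

*-nonNeg : ∀ {p q} → 0ℚ ℚ.≤ p → 0ℚ ℚ.≤ q → 0ℚ ℚ.≤ p * q
*-nonNeg {p} {q} 0≤p 0≤q = ℚ.nonNegative⁻¹ _ {{ℚ.nonNeg*nonNeg⇒nonNeg p {{ℚ.nonNegative 0≤p}} q {{ℚ.nonNegative 0≤q}}}}

*-mono-≤-nonNeg : ∀ {p q r s} → 0ℚ ℚ.≤ r → 0ℚ ℚ.≤ q → p ℚ.≤ q → r ℚ.≤ s → p * r ℚ.≤ q * s
*-mono-≤-nonNeg {p} {q} {r} {s} 0≤r 0≤q p≤q r≤s = ℚ.≤-trans
  (ℚ.*-monoʳ-≤-nonNeg r {{ℚ.nonNegative 0≤r}} p≤q) (ℚ.*-monoˡ-≤-nonNeg q {{ℚ.nonNegative 0≤q}} r≤s)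

-- The weight of `y` is the product of the values `κ` met when the bits of `y` are revealed in
-- order, each `κ` chosen for the slice reached so far. Both slices have weights of sum `ρ ^ n`, so
-- one more bit multiplies the sum by exactly `κ false + κ true`. Squaring avoids roots, and the
-- factor `∑ n f` lets slices be used without normalising, even when their mass is zero.
bhattacharyya-weight : ∀ n (f : Vec Bool n → ℚ) → (∀ y → 0ℚ ℚ.≤ f y) → CosetUniform f →
  ∃ λ (w : Vec Bool n → ℚ) → (∀ y → 0ℚ ℚ.≤ w y) × ∑ n w ≡ ρ ^ n ×
    (∀ y → f y * Ber⅓ n y ℚ.≤ ∑ n f * (w y * w y))
bhattacharyya-weight zero f 0≤f cu = (λ _ → 1ℚ) , (λ _ → from-yes (0ℚ ℚ.≤? 1ℚ)) , refl , λ where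
  Vec.[] → ℚ.≤-reflexive (cong (_* 1ℚ) (sym (ℚ.+-identityʳ (f Vec.[]))))
bhattacharyya-weight (suc n) f 0≤f cu =
  let κ , 0≤κ , κ-sum , κ-bound = first-bit n f 0≤f cu
      w₀ , 0≤w₀ , w₀-sum , w₀-bound = bhattacharyya-weight n (f ∘ (false Vec.∷_)) (0≤f ∘ _) (slice-cosetUniform f cu false)
      w₁ , 0≤w₁ , w₁-sum , w₁-bound = bhattacharyya-weight n (f ∘ (true Vec.∷_)) (0≤f ∘ _) (slice-cosetUniform f cu true)
  in
  (λ where (false Vec.∷ y) → κ false * w₀ y
           (true  Vec.∷ y) → κ true * w₁ y) ,
  (λ where (false Vec.∷ y) → *-nonNeg (0≤κ false) (0≤w₀ y)
           (true  Vec.∷ y) → *-nonNeg (0≤κ true) (0≤w₁ y)) ,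
  trans (∑-suc n _) (trans
    (cong₂ _+_ (trans (sumOver-*ˡ (κ false) (cube n) w₀) (cong (κ false *_) w₀-sum))
               (trans (sumOver-*ˡ (κ true) (cube n) w₁) (cong (κ true *_) w₁-sum)))
    (trans (sym (ℚ.*-distribʳ-+ (ρ ^ n) (κ false) (κ true))) (cong (_* ρ ^ n) κ-sum))) ,
  (λ where (false Vec.∷ y) → extend false (κ false) (w₀ y) (w₀-bound y) (κ-bound false)
           (true  Vec.∷ y) → extend true (κ true) (w₁ y) (w₁-bound y) (κ-bound true))
  where
  open ℚ.≤-Reasoning
  open +-*-Solver

  -- The mass of the slice is the total in the bound for the tail, and is itself bounded by the
  -- first-bit estimate; chaining the two eliminates it.
  extend : ∀ s k v {y} → f (s Vec.∷ y) * Ber⅓ n y ℚ.≤ ∑ n (f ∘ (s Vec.∷_)) * (v * v) →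
    bernoulli (+ 1 / 3) s * ∑ n (f ∘ (s Vec.∷_)) ℚ.≤ ∑ (suc n) f * (k * k) →
    f (s Vec.∷ y) * Ber⅓ (suc n) (s Vec.∷ y) ℚ.≤ ∑ (suc n) f * ((k * v) * (k * v))
  extend s k v {y} le le′ = begin
    F * (p * b)                    ≡⟨ solve 3 (λ F p b → F :* (p :* b) := p :* (F :* b)) refl F p b ⟩
    p * (F * b)                    ≤⟨ ℚ.*-monoˡ-≤-nonNeg p {{p-nonNeg s}} le ⟩
    p * (u * (v * v))              ≡⟨ ℚ.*-assoc p u (v * v) ⟨
    p * u * (v * v)                ≤⟨ ℚ.*-monoʳ-≤-nonNeg (v * v) {{square-nonNeg v}} le′ ⟩
    S * (k * k) * (v * v)          ≡⟨ solve 3 (λ S k v → S :* (k :* k) :* (v :* v) := S :* ((k :* v) :* (k :* v))) refl S k v ⟩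
    S * ((k * v) * (k * v))        ∎
    where
    F = f (s Vec.∷ y)
    p = bernoulli (+ 1 / 3) s
    b = Ber⅓ n y
    u = ∑ n (f ∘ (s Vec.∷_))
    S = ∑ (suc n) f
    p-nonNeg : ∀ s → ℚ.NonNegative (bernoulli (+ 1 / 3) s)
    p-nonNeg false = _
    p-nonNeg true  = _
    square-nonNeg : ∀ v → ℚ.NonNegative (v * v)
    square-nonNeg v = case ℚ.≤-total 0ℚ v of λ where
      (inj₁ 0≤v) → ℚ.nonNegative (*-nonNeg 0≤v 0≤v)
      (inj₂ v≤0) → ℚ.nonNegative (subst (0ℚ ℚ.≤_)
        (solve 1 (λ v → (:- v) :* (:- v) := v :* v) refl v)
        (*-nonNeg (ℚ.neg-antimono-≤ v≤0) (ℚ.neg-antimono-≤ v≤0)))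

-- Total masses, and invariance of the output distribution.

bernoulliProduct-sum : ∀ n → ∑ n (Ber⅓ n) ≡ 1ℚ
bernoulliProduct-sum zero    = refl
bernoulliProduct-sum (suc n) = begin
  ∑ (suc n) (Ber⅓ (suc n))                                ≡⟨ ∑-suc n (Ber⅓ (suc n)) ⟩
  ∑ n (λ y → b false * Ber⅓ n y) + ∑ n (λ y → b true * Ber⅓ n y) ≡⟨ cong₂ _+_ (scaled false) (scaled true) ⟩
  b false * 1ℚ + b true * 1ℚ                              ≡⟨⟩
  1ℚ                                                      ∎
  where
  open ≡-Reasoning
  b : Bool → ℚ
  b = bernoulli (+ 1 / 3)
  scaled : ∀ s → ∑ n (λ y → b s * Ber⅓ n y) ≡ b s * 1ℚ
  scaled s = trans (sumOver-*ˡ (b s) (cube n) (Ber⅓ n)) (cong (b s *_) (bernoulliProduct-sum n))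

-- Turns a probability given by counting into a sum of point masses, to which exchange of sums and
-- translation apply.
length-filter-/ : {P : A → Set} (P? : ∀ x → Dec (P x)) (xs : List A) (d : ℕ) .{{_ : ℕ.NonZero d}} →
  (+ length (filter P? xs)) / d ≡ sumOver xs (λ x → if does (P? x) then + 1 / d else 0ℚ)
length-filter-/ P? []       d = ℚ.0/n≡0 d
length-filter-/ P? (x ∷ xs) d with does (P? x)
... | true  = trans (sym (/-+ 1 (length (filter P? xs)) d)) (cong (_+_ (+ 1 / d)) (length-filter-/ P? xs d))
... | false = trans (length-filter-/ P? xs d) (sym (ℚ.+-identityˡ _))

∑-point : ∀ n (v : Vec Bool n) q → ∑ n (λ y → if does (≡-dec Bool._≟_ v y) then q else 0ℚ) ≡ q
∑-point zero    Vec.[]          q = ℚ.+-identityʳ q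
-- Head comparison computes under `does`, so the half with the other head is a sum of literal zeros.
∑-point (suc n) (false Vec.∷ v) q = trans (∑-suc n _)
  (trans (cong₂ _+_ (∑-point n v q) (sumOver-0 (cube n))) (ℚ.+-identityʳ q))
∑-point (suc n) (true Vec.∷ v)  q = trans (∑-suc n _)
  (trans (cong₂ _+_ (sumOver-0 (cube n)) (∑-point n v q)) (ℚ.+-identityˡ q))

module _ {m n : ℕ} (L : Fin n → Vec F₂ m → F₂) where

  private instance
    2^m≢0 : ℕ.NonZero (2 ℕ.^ m)
    2^m≢0 = m^n≢0 2 m

  outputs : Vec F₂ m → Vec Bool n
  outputs x = tabulate (λ i → L i x)

  mass : Vec Bool n → Vec F₂ m → ℚ
  mass y x = if does (≡-dec Bool._≟_ (outputs x) y) then + 1 / (2 ℕ.^ m) else 0ℚ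

  outputDistribution-∑ : ∀ y → outputDistribution L y ≡ ∑ m (mass y)
  outputDistribution-∑ y = length-filter-/ (λ x → ≡-dec Bool._≟_ (outputs x) y) (cube m) (2 ℕ.^ m)

  outputDistribution-nonNeg : ∀ y → 0ℚ ℚ.≤ outputDistribution L y
  outputDistribution-nonNeg y = subst (0ℚ ℚ.≤_) (sym (outputDistribution-∑ y))
    (sumOver-nonNeg (cube m) mass-nonNeg)
    where
    mass-nonNeg : ∀ x → 0ℚ ℚ.≤ mass y x
    mass-nonNeg x with does (≡-dec Bool._≟_ (outputs x) y)
    ... | true  = ℚ.nonNegative⁻¹ _ {{ℚ.normalize-nonNeg 1 (2 ℕ.^ m)}}
    ... | false = ℚ.≤-refl

  -- After exchanging the sums, each input contributes its mass to exactly one output.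
  outputDistribution-sum : ∑ n (outputDistribution L) ≡ 1ℚ
  outputDistribution-sum = begin
    ∑ n (outputDistribution L)              ≡⟨ sumOver-cong (cube n) outputDistribution-∑ ⟩
    ∑ n (λ y → ∑ m (mass y))                ≡⟨ sumOver-swap (cube n) (cube m) mass ⟩
    ∑ m (λ x → ∑ n (λ y → mass y x))        ≡⟨ sumOver-cong (cube m) (λ x → ∑-point n (outputs x) _) ⟩
    ∑ m (λ _ → + 1 / (2 ℕ.^ m))             ≡⟨ ∑-const m 1 (2 ℕ.^ m) ⟩
    (+ (2 ℕ.^ m ℕ.* 1)) / (2 ℕ.^ m)         ≡⟨ cong (λ k → (+ k) / (2 ℕ.^ m)) (ℕ.*-identityʳ (2 ℕ.^ m)) ⟩
    (+ (2 ℕ.^ m)) / (2 ℕ.^ m)               ≡⟨ n/n≡1 (2 ℕ.^ m) ⟩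
    1ℚ                                      ∎
    where
    open ≡-Reasoning
    n/n≡1 : ∀ d .{{_ : ℕ.NonZero d}} → (+ d) / d ≡ 1ℚ
    n/n≡1 d@(suc _) = ℚ.fromℚᵘ-cong {(+ d) ℚᵘ./ d} {ℚᵘ.1ℚᵘ} (ℚᵘ.*≡* (ℤ.*-comm (+ d) (+ 1)))

  support-outputs : ∀ y → outputDistribution L y ≢ 0ℚ → ∃ λ x → outputs x ≡ y
  support-outputs y Dy≢0 with zero-or-support m (mass y)
  ... | inj₁ mass≡0 = contradiction
    (trans (outputDistribution-∑ y) (trans (sumOver-cong (cube m) mass≡0) (sumOver-0 (cube m)))) Dy≢0
  ... | inj₂ (x , mass≢0) = x , outputs≡ x mass≢0
    where
    outputs≡ : ∀ x → mass y x ≢ 0ℚ → outputs x ≡ y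
    outputs≡ x mass≢0 with ≡-dec Bool._≟_ (outputs x) y
    ... | yes eq = eq
    ... | no _   = contradiction refl mass≢0

  -- If `x₁` and `x₂` are inputs mapped to `a` and `b`, translation by `x₁ ⊕ x₂` is a bijection
  -- between the fibres over `c` and over `c ⊕ (a ⊕ b)`. The sum of three terms expresses affinity
  -- without separating the constant part of the map.
  outputDistribution-cosetUniform : (∀ x y z → outputs (x ⊕ (y ⊕ z)) ≡ outputs x ⊕ (outputs y ⊕ outputs z)) →
    CosetUniform (outputDistribution L)
  outputDistribution-cosetUniform affine a b c Da≢0 Db≢0
    with x₁ , refl ← support-outputs a Da≢0 | x₂ , refl ← support-outputs b Db≢0 = begin
    outputDistribution L (c ⊕ t)            ≡⟨ outputDistribution-∑ (c ⊕ t) ⟩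
    ∑ m (mass (c ⊕ t))                      ≡⟨ ∑-translate m (x₁ ⊕ x₂) (mass (c ⊕ t)) ⟨
    ∑ m (λ x → mass (c ⊕ t) (x ⊕ (x₁ ⊕ x₂))) ≡⟨ sumOver-cong (cube m) (λ x → cong (λ r → if r then + 1 / (2 ℕ.^ m) else 0ℚ)
      (does-⇔ (shift x) (≡-dec Bool._≟_ (outputs (x ⊕ (x₁ ⊕ x₂))) (c ⊕ t)) (≡-dec Bool._≟_ (outputs x) c))) ⟩
    ∑ m (mass c)                            ≡⟨ outputDistribution-∑ c ⟨
    outputDistribution L c                  ∎
    where
    open ≡-Reasoning
    t = outputs x₁ ⊕ outputs x₂
    shift : ∀ x → outputs (x ⊕ (x₁ ⊕ x₂)) ≡ c ⊕ t ⇔ outputs x ≡ c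
    shift x = mk⇔
      (λ eq → trans (sym (⊕-cancelʳ (outputs x) t))
        (trans (cong (_⊕ t) (trans (sym (affine x x₁ x₂)) eq)) (⊕-cancelʳ c t)))
      (λ eq → trans (affine x x₁ x₂) (cong (_⊕ t) eq))

-- Polynomials of degree at most one are affine.

xor-interchange₃ : ∀ a b c d e f →
  (a xor (b xor c)) xor (d xor (e xor f)) ≡ (a xor d) xor ((b xor e) xor (c xor f))
xor-interchange₃ a b c d e f = trans (xor-interchange a (b xor c) d (e xor f))
  (cong ((a xor d) xor_) (xor-interchange b c e f))
  where xor-interchange = interchange (CommutativeRing.+-commutativeSemigroup xor-∧-commutativeRing)

monomial-constant : (S : Subset m) → card S ≡ 0 → ∀ x → monomial S x ≡ true
monomial-constant Vec.[]          _   Vec.[]      = refl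
monomial-constant (false Vec.∷ S) S≡0 (_ Vec.∷ x) = monomial-constant S S≡0 x

-- Such a monomial is a single variable or the constant `true`; the constant is preserved because an
-- odd number of copies of `true` sums to `true`.
monomial-affine : (S : Subset m) → card S ≤ 1 → ∀ x y z →
  monomial S (x ⊕ (y ⊕ z)) ≡ monomial S x xor (monomial S y xor monomial S z)
monomial-affine Vec.[]          _   Vec.[]      Vec.[]      Vec.[]      = refl
monomial-affine (false Vec.∷ S) S≤1 (_ Vec.∷ x) (_ Vec.∷ y) (_ Vec.∷ z) = monomial-affine S S≤1 x y z
monomial-affine (true Vec.∷ S)  S≤1 (a Vec.∷ x) (b Vec.∷ y) (c Vec.∷ z) =
  trans (head _ (x ⊕ (y ⊕ z))) (sym (cong₂ _xor_ (head a x) (cong₂ _xor_ (head b y) (head c z))))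
  where
  head : ∀ d v → monomial (true Vec.∷ S) (d Vec.∷ v) ≡ d
  head d v = trans (cong (d ∧_) (monomial-constant S (ℕ.n≤0⇒n≡0 (ℕ.s≤s⁻¹ S≤1)) v)) (Bool.∧-identityʳ d)

eval-affine : (p : Polynomial m) → All (λ S → card S ≤ 1) p → ∀ x y z →
  eval p (x ⊕ (y ⊕ z)) ≡ eval p x xor (eval p y xor eval p z)
eval-affine []      []          x y z = refl
eval-affine (S ∷ p) (S≤1 ∷ p≤1) x y z =
  trans (cong₂ _xor_ (monomial-affine S S≤1 x y z) (eval-affine p p≤1 x y z))
    (xor-interchange₃ (monomial S x) (monomial S y) (monomial S z) (eval p x) (eval p y) (eval p z))

degree≤1-affine : {f : Vec F₂ m → F₂} → HasDegreeAtMost 1 f → ∀ x y z → f (x ⊕ (y ⊕ z)) ≡ f x xor (f y xor f z)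
degree≤1-affine (p , p≤1 , f≗p) x y z
  rewrite f≗p (x ⊕ (y ⊕ z)) | f≗p x | f≗p y | f≗p z = eval-affine p p≤1 x y z

tabulate-⊕ : (f g : Fin n → Bool) → tabulate (λ i → f i xor g i) ≡ tabulate f ⊕ tabulate g
tabulate-⊕ {zero}  f g = refl
tabulate-⊕ {suc n} f g = cong ((f Fin.zero xor g Fin.zero) Vec.∷_) (tabulate-⊕ (f ∘ Fin.suc) (g ∘ Fin.suc))

outputs-affine : (L : Fin n → Vec F₂ m → F₂) → (∀ i → HasDegreeAtMost 1 (L i)) → ∀ x y z →
  outputs L (x ⊕ (y ⊕ z)) ≡ outputs L x ⊕ (outputs L y ⊕ outputs L z)
outputs-affine L deg x y z = trans (Vec.tabulate-cong (λ i → degree≤1-affine (deg i) x y z))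
  (trans (tabulate-⊕ (λ i → L i x) (λ i → L i y xor L i z))
    (cong (outputs L x ⊕_) (tabulate-⊕ (λ i → L i y) (λ i → L i z))))

-- Total variation and overlap.

-- A root-free form of the bound of a minimum by the geometric mean: two numbers above `r` would
-- have a product above its square.
*-≤-square⇒min≤ : ∀ {p q r} → 0ℚ ℚ.≤ r → p * q ℚ.≤ r * r → p ℚ.≤ r ⊎ q ℚ.≤ r
*-≤-square⇒min≤ {p} {q} {r} 0≤r pq≤rr with p ℚ.≤? r | q ℚ.≤? r
... | yes p≤r | _       = inj₁ p≤r
... | no _    | yes q≤r = inj₂ q≤r
... | no p≰r  | no q≰r  = contradiction (begin-strict
  r * r  ≤⟨ ℚ.*-monoˡ-≤-nonNeg r {{ℚ.nonNegative 0≤r}} (ℚ.<⇒≤ (ℚ.≰⇒> q≰r)) ⟩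
  -- Strictness is taken here, where the factor `q` is positive; the previous step is an equality
  -- when `r` is zero.
  r * q  <⟨ ℚ.*-monoˡ-<-pos q {{ℚ.positive (ℚ.≤-<-trans 0≤r (ℚ.≰⇒> q≰r))}} (ℚ.≰⇒> p≰r) ⟩
  p * q  ≤⟨ pq≤rr ⟩
  r * r  ∎) (ℚ.<-irrefl refl)
  where open ℚ.≤-Reasoning

p≤∣p∣ : ∀ p → p ℚ.≤ ∣ p ∣
p≤∣p∣ p = case ℚ.≤-total 0ℚ p of λ where
  (inj₁ 0≤p) → ℚ.≤-reflexive (sym (ℚ.0≤p⇒∣p∣≡p 0≤p))
  (inj₂ p≤0) → ℚ.≤-trans p≤0 (ℚ.0≤∣p∣ p)

-- The sum of two numbers is twice the smaller one plus their distance, and the smaller one is at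
-- most `r`.
+-≤-double+∣-∣ : ∀ {p q r} → p ℚ.≤ r ⊎ q ℚ.≤ r → p + q ℚ.≤ (r + r) + ∣ p - q ∣
+-≤-double+∣-∣ {p} {q} {r} (inj₁ p≤r) = begin
  p + q                  ≡⟨ solve 2 (λ p q → p :+ q := (p :+ p) :+ :- (p :- q)) refl p q ⟩
  (p + p) + - (p - q)    ≤⟨ ℚ.+-mono-≤ (ℚ.+-mono-≤ p≤r p≤r) (p≤∣p∣ (- (p - q))) ⟩
  (r + r) + ∣ - (p - q) ∣ ≡⟨ cong (_+_ (r + r)) (ℚ.∣-p∣≡∣p∣ (p - q)) ⟩
  (r + r) + ∣ p - q ∣    ∎
  where
  open ℚ.≤-Reasoning
  open +-*-Solver
+-≤-double+∣-∣ {p} {q} {r} (inj₂ q≤r) = begin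
  p + q                  ≡⟨ solve 2 (λ p q → p :+ q := (q :+ q) :+ (p :- q)) refl p q ⟩
  (q + q) + (p - q)      ≤⟨ ℚ.+-mono-≤ (ℚ.+-mono-≤ q≤r q≤r) (p≤∣p∣ (p - q)) ⟩
  (r + r) + ∣ p - q ∣    ∎
  where
  open ℚ.≤-Reasoning
  open +-*-Solver

-- Summing the pointwise bound over the cube gives `1ℚ + 1ℚ` on the left and twice `∑ n w + TV D E`
-- on the right.
1-TV≤∑ : (D E : PMF n) (w : Vec Bool n → ℚ) → ∑ n D ≡ 1ℚ → ∑ n E ≡ 1ℚ →
  (∀ y → 0ℚ ℚ.≤ w y) → (∀ y → D y * E y ℚ.≤ w y * w y) → 1ℚ - TV D E ℚ.≤ ∑ n w
1-TV≤∑ {n} D E w ∑D≡1 ∑E≡1 0≤w DE≤ww = begin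
  1ℚ - ½ * X                         ≡⟨ solve 1 (λ X → con 1ℚ :- con ½ :* X := con ½ :* ((con 1ℚ :+ con 1ℚ) :- X)) refl X ⟩
  ½ * ((1ℚ + 1ℚ) - X)                ≤⟨ ℚ.*-monoˡ-≤-nonNeg ½ (ℚ.+-monoˡ-≤ (- X) total) ⟩
  ½ * ((∑ n w + ∑ n w + X) - X)      ≡⟨ solve 2 (λ W X → con ½ :* ((W :+ W :+ X) :- X) := W) refl (∑ n w) X ⟩
  ∑ n w                              ∎
  where
  open ℚ.≤-Reasoning
  open +-*-Solver
  X = ∑ n (λ y → ∣ D y - E y ∣)
  total : 1ℚ + 1ℚ ℚ.≤ ∑ n w + ∑ n w + X
  total = begin
    1ℚ + 1ℚ                                          ≡⟨ cong₂ _+_ ∑D≡1 ∑E≡1 ⟨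
    ∑ n D + ∑ n E                                    ≡⟨ sumOver-+ (cube n) D E ⟨
    ∑ n (λ y → D y + E y)                            ≤⟨ sumOver-mono (cube n) (λ y → +-≤-double+∣-∣ {D y} {E y} (*-≤-square⇒min≤ (0≤w y) (DE≤ww y))) ⟩
    ∑ n (λ y → (w y + w y) + ∣ D y - E y ∣)          ≡⟨ sumOver-+ (cube n) (λ y → w y + w y) _ ⟩
    ∑ n (λ y → w y + w y) + X                        ≡⟨ cong (_+ X) (sumOver-+ (cube n) w w) ⟩
    ∑ n w + ∑ n w + X                                ∎

-- Powers and the exponential rate.

^-nonNeg : ∀ {p} → 0ℚ ℚ.≤ p → ∀ k → 0ℚ ℚ.≤ p ^ k
^-nonNeg 0≤p zero    = from-yes (0ℚ ℚ.≤? 1ℚ)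
^-nonNeg 0≤p (suc k) = *-nonNeg 0≤p (^-nonNeg 0≤p k)

^-monoˡ-≤ : ∀ {p q} → 0ℚ ℚ.≤ p → p ℚ.≤ q → ∀ k → p ^ k ℚ.≤ q ^ k
^-monoˡ-≤ 0≤p p≤q zero    = ℚ.≤-refl
^-monoˡ-≤ 0≤p p≤q (suc k) =
  *-mono-≤-nonNeg (^-nonNeg 0≤p k) (ℚ.≤-trans 0≤p p≤q) p≤q (^-monoˡ-≤ 0≤p p≤q k)

ρ^n^49≤½^n : ∀ n → (ρ ^ n) ^ 49 ℚ.≤ ½ ^ n
ρ^n^49≤½^n n = begin
  (ρ ^ n) ^ 49       ≡⟨ ×-assocˡ ρ 49 n ⟩
  ρ ^ (49 ℕ.* n)     ≡⟨ cong (ρ ^_) (ℕ.*-comm 49 n) ⟩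
  ρ ^ (n ℕ.* 49)     ≡⟨ ×-assocˡ ρ n 49 ⟨
  -- 49 is the least exponent `k` with `ρ ^ k` at most `½`.
  (ρ ^ 49) ^ n       ≤⟨ ^-monoˡ-≤ (from-yes (0ℚ ℚ.≤? ρ ^ 49)) (from-yes (ρ ^ 49 ℚ.≤? ½)) n ⟩
  ½ ^ n              ∎
  where open ℚ.≤-Reasoning

2^ℤ-neg : ∀ n → 2^ℤ (ℤ.- (+ n)) ≡ ½ ^ n
2^ℤ-neg zero    = refl
2^ℤ-neg (suc n) = refl

-- The exponent computes to a fraction with denominator 49 and numerator `-(1 * n)`, so the second
-- alternative of `_≤2^_` asks for `q ^ 49 ≤ ½ ^ n`. Monotonicity of powers needs `q` nonnegative; a
-- nonpositive `q` falls under the first alternative.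
≤ρ^n⇒≤2^ : ∀ n {q} → q ℚ.≤ ρ ^ n → q ≤2^ ℚᵘ.- (toℚᵘ (+ 1 / 49) ℚᵘ.* (+ n ℚᵘ./ 1))
≤ρ^n⇒≤2^ n {q} q≤ρ^n = case ℚ.≤-total q 0ℚ of λ where
  (inj₁ q≤0) → inj₁ q≤0
  (inj₂ 0≤q) → inj₂ (subst (q ^ 49 ℚ.≤_)
    (sym (trans (cong (λ k → 2^ℤ (ℤ.- k)) (ℤ.*-identityˡ (+ n))) (2^ℤ-neg n)))
    (ℚ.≤-trans (^-monoˡ-≤ 0≤q q≤ρ^n 49) (ρ^n^49≤½^n n)))

theorem7p1 : ∃ λ (c : ℚ) → 0ℚ < c × ∃ λ (N : ℕ) → ∀ (n : ℕ) → N ≤ n →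
    ∀ (m : ℕ) (L : Fin n → Vec F₂ m → F₂) → (∀ i → HasDegreeAtMost 1 (L i)) →
    1ℚ - TV (outputDistribution L) (bernoulliProduct (+ 1 / 3) n) ≤2^ ℚᵘ.- (toℚᵘ c ℚᵘ.* (+ n ℚᵘ./ 1))
-- The rate 1/49 comes from `ρ^n^49≤½^n`; the threshold is 0 because the bound holds for every `n`.
theorem7p1 = + 1 / 49 , from-yes (0ℚ ℚ.<? + 1 / 49) , 0 , λ n _ m L deg →
  let D = outputDistribution L
      w , 0≤w , ∑w≡ρ^n , D*B≤ = bhattacharyya-weight n D (outputDistribution-nonNeg L)
        (outputDistribution-cosetUniform L (outputs-affine L deg))
      -- The factor `∑ n D` in the weight bound is the total mass 1.
      D*B≤ww y = subst (D y * Ber⅓ n y ℚ.≤_)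
        (trans (cong (_* (w y * w y)) (outputDistribution-sum L)) (ℚ.*-identityˡ (w y * w y))) (D*B≤ y)
  in
  ≤ρ^n⇒≤2^ n (subst (1ℚ - TV D (Ber⅓ n) ℚ.≤_) ∑w≡ρ^n
    (1-TV≤∑ D (Ber⅓ n) w (outputDistribution-sum L) (bernoulliProduct-sum n) 0≤w D*B≤ww))
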